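{- For any graph $G$ with at least one edge, with chromatic index $c$ and fractional chromatic index $c_f$, \[\left\lfloor\tfrac{1}{2c}|E(G)|\right\rfloor-1 \leq \mathrm{cms}(G) \leq \tfrac{1}{c_f}|E(G)|.\] Furthermore, for any integers $\Delta \geq 2$ and $n \geq \Delta+1$, there is a graph $G$ of order $n$ such that $\mathrm{cms}(G) \leq \frac{1}{\Delta+1}|E(G)|$.
   Context: All graphs are finite and simple. For a graph $G$ with $m$ edges, an ordering of $G$ is a bijection $\ell: E(G)\to\mathbb{Z}_m$. For distinct edges $e,e'$, $d_\ell(e,e')$ is the smallest positive integer $d$ with $\ell(e)+d=\ell(e')$ in $\mathbb{Z}_m$, and $d_\ell\{e,e'\}=\min\{d_\ell(e,e'),d_\ell(e',e)\}$. Two edges are adjacent if they share a vertex. $\mathrm{cms}(\ell)$ is the largest $s\in\{1,\dots,m\}$ such that $d_\ell\{e,e'\}\geq s$ for every pair of adjacent edges; $\mathrm{cms}(G)$ is the maximum of $\mathrm{cms}(\ell)$ over all orderings of $G$. The chromatic index is the minimum number of colours in a proper edge colouring. Let $\mathcal{M}(G)$ be the set of matchings of $G$ and $\mathcal{M}_e(G)$ those containing edge $e$; a fractional edge colouring is a function $\omega:\mathcal{M}(G)\to\mathbb{R}_{\geq 0}$ with $\sum_{M\in\mathcal{M}_e(G)}\omega(M)\geq 1$ for each edge $e$, its weight is $\sum_{M}\omega(M)$, and the fractional chromatic index $c_f$ is the infimum of the weights of fractional edge colourings. -}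

module Defs where

open import Data.Nat using (ℕ; zero; suc; _+_; _*_; _∸_; _≤_; _%_; _/_)
open import Data.Nat.Properties using ()
open import Data.Fin using (Fin; toℕ)
open import Data.Fin.Permutation using (Permutation′; _⟨$⟩ʳ_)
open import Data.Bool using (Bool; true; false)
open import Data.Vec using (Vec; lookup)
open import Data.List using (List; []; _∷_)
open import Data.List.Relation.Unary.All using (All)
open import Data.Product using (Σ; ∃; _×_; _,_; proj₁; proj₂)
open import Data.Sum using (_⊎_)
open import Data.Integer using (+_)
open import Data.Rational using (ℚ; 0ℚ; 1ℚ) renaming (_+_ to _+ℚ_; _≤_ to _≤ℚ_)
open import Relation.Binary.PropositionalEquality using (_≡_; _≢_)
open import Relation.Nullary using (¬_)

record Graph : Set where
  field
    n     : ℕ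
    m     : ℕ
    ends  : Fin m → Fin n × Fin n
    loopless : ∀ e → proj₁ (ends e) ≢ proj₂ (ends e)
    simple : ∀ e e' →
      ((proj₁ (ends e) ≡ proj₁ (ends e') × proj₂ (ends e) ≡ proj₂ (ends e'))
       ⊎ (proj₁ (ends e) ≡ proj₂ (ends e') × proj₂ (ends e) ≡ proj₁ (ends e')))
      → e ≡ e'

open Graph public

Incident : (G : Graph) → Fin (n G) → Fin (m G) → Set
Incident G v e = v ≡ proj₁ (ends G e) ⊎ v ≡ proj₂ (ends G e)

Adjacent : (G : Graph) → Fin (m G) → Fin (m G) → Set
Adjacent G e e' = e ≢ e' × ∃ λ v → Incident G v e × Incident G v e'

-- An ordering of G: a bijection E(G) → ℤ_m (ℤ_m represented by Fin m).
Ordering : Graph → Set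
Ordering G = Permutation′ (m G)

-- For a ≢ b in ℤ_m (m ≥ 1): the smallest positive d with a + d = b in ℤ_m,
-- namely (b - a) mod m.  (Only used for distinct labels.)
cycDist : (k : ℕ) → Fin k → Fin k → ℕ
cycDist zero    a b = 0
cycDist (suc k) a b = (toℕ b + (suc k ∸ toℕ a)) % suc k

dist : (G : Graph) → Ordering G → Fin (m G) → Fin (m G) → ℕ
dist G ℓ e e' = cycDist (m G) (ℓ ⟨$⟩ʳ e) (ℓ ⟨$⟩ʳ e')

-- s ≤ d_ℓ{e,e'} = min (d_ℓ(e,e')) (d_ℓ(e',e))
-- ℓ is s-separating: d_ℓ{e,e'} ≥ s for all adjacent e, e'
Separating : (G : Graph) → Ordering G → ℕ → Set
Separating G ℓ s = ∀ e e' → Adjacent G e e' →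
  s ≤ dist G ℓ e e' × s ≤ dist G ℓ e' e

IsCmsOrdering : (G : Graph) → Ordering G → ℕ → Set
IsCmsOrdering G ℓ k = (1 ≤ k × k ≤ m G × Separating G ℓ k)
  × (∀ s → 1 ≤ s → s ≤ m G → Separating G ℓ s → s ≤ k)

IsCms : Graph → ℕ → Set
IsCms G k = (∃ λ ℓ → IsCmsOrdering G ℓ k)
  × (∀ ℓ k' → IsCmsOrdering G ℓ k' → k' ≤ k)

ProperEdgeColouring : (G : Graph) → ℕ → Set
ProperEdgeColouring G c = Σ (Fin (m G) → Fin c) λ col →
  ∀ e e' → Adjacent G e e' → col e ≢ col e'

IsChromaticIndex : Graph → ℕ → Set
IsChromaticIndex G c = ProperEdgeColouring G c
  × (∀ c' → ProperEdgeColouring G c' → c ≤ c')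

IsMatching : (G : Graph) → Vec Bool (m G) → Set
IsMatching G M = ∀ e e' → lookup M e ≡ true → lookup M e' ≡ true →
  ¬ Adjacent G e e'

Matching : Graph → Set
Matching G = Σ (Vec Bool (m G)) (IsMatching G)

-- A (finitely supported, rational-valued) weighting of matchings,
-- given as a list of (matching , weight ω(M)) pairs.
Weighting : Graph → Set
Weighting G = List (Matching G × ℚ)

weight : (G : Graph) → Weighting G → ℚ
weight G []             = 0ℚ
weight G ((M , w) ∷ ω)  = w +ℚ weight G ω

weightAt : (G : Graph) → Weighting G → Fin (m G) → ℚ
weightAt G []                  e = 0ℚ
weightAt G (((M , _) , w) ∷ ω) e with lookup M e
... | true  = w +ℚ weightAt G ω e
... | false = weightAt G ω e

IsFractionalEdgeColouring : (G : Graph) → Weighting G → Set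
IsFractionalEdgeColouring G ω =
  All (λ p → 0ℚ ≤ℚ proj₂ p) ω × (∀ e → 1ℚ ≤ℚ weightAt G ω e)

-- q is a lower bound for the weights of fractional edge colourings
-- (so c_f = inf of these weights is the greatest such q)
LowerBoundFrac : Graph → ℚ → Set
LowerBoundFrac G q = ∀ ω → IsFractionalEdgeColouring G ω → q ≤ℚ weight G ω

-- ⌊ m / (2c) ⌋  (the case c = 0 never arises for graphs with an edge)
floorHalfDiv : ℕ → ℕ → ℕ
floorHalfDiv m zero    = 0
floorHalfDiv m (suc c) = m / (2 * suc c)

{-# OPTIONS --safe #-}
-- Lower bound. Shifting single edges between colour classes makes all c classes have at least 2s edges,
-- s = ⌊m / 2c⌋. Concatenate the classes, ordering each of them greedily from both ends inwards. When k
-- more edges are needed at either end, only k - 1 edges of the neighbouring class are still too close;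
-- they have at most 2(k - 1) endpoints, and since 2k edges of the matching remain, one of them avoids
-- all these endpoints. The last class is ordered against both its neighbours, which closes the cycle.
--
-- Upper bound. For a k-separating ordering the m cyclic windows of length k are matchings; with weight
-- 1/k each they form a fractional edge colouring of weight m/k.
--
-- Example. In a star with one extra edge, the two labels after that of the extra edge belong to edges
-- of the star, so cms = 1, while the graph has n edges.
module Submission where

open import Defs
open import Data.Nat as ℕ
  using (ℕ; zero; suc; pred; _+_; _*_; _∸_; _%_; _≤_; _<_; z≤n; s≤s; _≤?_; _<?_; _≟_)
open import Data.Nat.Properties
open import Data.Nat.DivMod using (m<n⇒m%n≡m; [m+n]%n≡m%n; m/n*n≤m)
open import Data.Nat.ListAction using (sum)
open import Data.Nat.ListAction.Properties using (sum-↭)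
open import Data.Nat.Tactic.RingSolver using (solve-∀)
open import Data.Bool using (true; false)
open import Data.Integer as ℤ using (+_)
import Data.Integer.Properties as ℤ
open import Data.Rational as ℚ using (ℚ; 0ℚ; 1ℚ; _/_) renaming (_+_ to _+ℚ_; _*_ to _*ℚ_; _≤_ to _≤ℚ_)
import Data.Rational.Properties as ℚ
import Data.Rational.Unnormalised as ℚᵘ
import Data.Rational.Unnormalised.Properties as ℚᵘ
open import Data.Fin as Fin using (Fin; toℕ; fromℕ<)
import Data.Fin.Properties as Fin
open import Data.Fin.Permutation as Perm using (permutation; _⟨$⟩ʳ_; _⟨$⟩ˡ_)
import Data.Vec as Vec
open import Data.Vec.Properties using (lookup∘tabulate)
open import Data.List
  using (List; []; _∷_; _++_; _ʳ++_; length; take; concat; map; reverse; filter; lookup; allFin)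
open import Data.List.Properties
  using (length-++; length-tabulate; ++-assoc; ++-identityʳ; ++-ʳ++; ʳ++-ʳ++; partition-defn)
open import Data.List.Relation.Unary.All as All using (All; []; _∷_)
import Data.List.Relation.Unary.All.Properties as All
open import Data.List.Relation.Unary.Any using (Any; here; there; any?; index)
open import Data.List.Relation.Unary.Any.Properties using (lookup-index)
open import Data.List.Relation.Unary.AllPairs as AllPairs using (AllPairs; []; _∷_)
import Data.List.Relation.Unary.AllPairs.Properties as AllPairs
open import Data.List.Relation.Unary.Unique.Propositional using (Unique)
import Data.List.Relation.Unary.Unique.Propositional.Properties as Unique
open import Data.List.Membership.Propositional using (_∈_; find)
open import Data.List.Membership.Propositional.Properties using (∈-∃++; ∈-allFin; ∈-filter⁺; ∈-lookup)
open import Data.List.Relation.Binary.Permutation.Propositional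
  using (_↭_; prep; swap; ↭-refl; ↭-sym; ↭-trans; ↭-reflexive; ↭⇒↭ₛ; ↭ₛ⇒↭; module PermutationReasoning)
open import Data.List.Relation.Binary.Permutation.Propositional.Properties
  using (All-resp-↭; Any-resp-↭; ∈-resp-↭; ↭-length; shift; shifts; ++⁺ˡ; ++⁺ʳ; ++⁺; ++-comm; ++↭ʳ++)
  renaming (map⁺ to ↭-map⁺)
import Data.List.Relation.Binary.Permutation.Setoid.Properties as SetoidPermutation
open import Data.Product using (Σ; ∃; ∃₂; _×_; _,_; proj₁; proj₂)
open import Data.Sum as Sum using (_⊎_; inj₁; inj₂)
open import Data.Unit using (⊤; tt)
open import Function using (_∘_; id)
open import Relation.Nullary using (¬_; Dec; yes; no; contradiction; does)
open import Relation.Nullary.Decidable using (_⊎-dec_; _×-dec_; _→-dec_; ¬?)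
open import Relation.Binary using (Symmetric)
open import Relation.Binary.PropositionalEquality
  using (_≡_; _≢_; refl; sym; trans; cong; cong₂; subst; subst₂; resp₂; setoid; module ≡-Reasoning)

private variable
  A B : Set

-- Lists up to permutation.

AllPairs-resp-↭ : {R : A → A → Set} → Symmetric R → {xs ys : List A} →
  xs ↭ ys → AllPairs R xs → AllPairs R ys
AllPairs-resp-↭ {A} {R} sym-R xs↭ys =
  SetoidPermutation.AllPairs-resp-↭ (setoid A) sym-R (resp₂ R) (↭⇒↭ₛ xs↭ys)

AllPairs-++⁻ : {R : A → A → Set} (xs : List A) {ys : List A} → AllPairs R (xs ++ ys) →
  AllPairs R xs × AllPairs R ys × All (λ x → All (R x) ys) xs
AllPairs-++⁻ []       p       = [] , p , []
AllPairs-++⁻ (x ∷ xs) (r ∷ p) with AllPairs-++⁻ xs p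
... | pxs , pys , c = (All.++⁻ˡ xs r ∷ pxs) , pys , (All.++⁻ʳ xs r ∷ c)

extract : {P : A → Set} {xs : List A} → Any P xs → ∃₂ λ x xs' → P x × xs ↭ x ∷ xs'
extract any with find any
... | x , x∈xs , px with ∈-∃++ x∈xs
...   | as , bs , refl = x , as ++ bs , px , shift x as bs

concat-resp-↭ : {xss yss : List (List A)} → xss ↭ yss → concat xss ↭ concat yss
concat-resp-↭ _↭_.refl          = ↭-refl
concat-resp-↭ (prep xs p)       = ++⁺ˡ xs (concat-resp-↭ p)
concat-resp-↭ (swap xs ys p) =
  ↭-trans (shifts xs ys) (++⁺ˡ ys (++⁺ˡ xs (concat-resp-↭ p)))
concat-resp-↭ (_↭_.trans p q)   = ↭-trans (concat-resp-↭ p) (concat-resp-↭ q)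

-- By disjointness each `w` is related to at most one entry of `xs`, so it rules out at most one,
-- and some entry survives all of `ws`. This serves for vertices against vertices in
-- `uncovered-vertex` and for edges against vertices in `choose`.
avoid : {R : A → B → Set} → (∀ x w → Dec (R x w)) → (xs : List A) (ws : List B) →
  AllPairs (λ x y → ∀ w → R x w → ¬ R y w) xs → length ws < length xs →
  ∃₂ λ x xs' → xs ↭ x ∷ xs' × All (λ w → ¬ R x w) ws
avoid R? (x ∷ xs) []       disj _    = x , xs , ↭-refl , []
avoid R? xs       (w ∷ ws) disj w<x with any? (λ x → R? x w) xs
... | no ¬any with avoid R? xs ws disj (<-trans (n<1+n _) w<x)
...   | x , xs' , xs↭ , ¬R = x , xs' , xs↭ , All.head (All-resp-↭ xs↭ (All.¬Any⇒All¬ xs ¬any)) ∷ ¬R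
avoid {A} {R = R} R? xs (w ∷ ws) disj w<x | yes any with extract any
... | z , zs , Rzw , xs↭
  with AllPairs-resp-↭ {R = λ x y → ∀ w → R x w → ¬ R y w} (λ r w p q → r w q p) xs↭ disj
...   | dz ∷ dzs with avoid R? zs ws dzs (≤-pred (subst (suc (length ws) <_) (↭-length xs↭) w<x))
...     | x , xs' , zs↭ , ¬R = x , z ∷ xs' , ↭-trans xs↭ (↭-trans (prep z zs↭) (swap z x ↭-refl)) ,
          (λ Rxw → All.head (All-resp-↭ zs↭ dz) w Rzw Rxw) ∷ ¬R

-- Matchings as lists of edges

module _ (G : Graph) where

  private
    V = Fin (n G)
    E = Fin (m G)
    Inc = Incident G

  Disj : E → E → Set
  Disj e f = ∀ v → Inc v e → ¬ Inc v f

  Disj-sym : Symmetric Disj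
  Disj-sym d v p q = d v q p

  MatchingList : List E → Set
  MatchingList = AllPairs Disj

  MatchingList-resp-↭ : {es fs : List E} → es ↭ fs → MatchingList es → MatchingList fs
  MatchingList-resp-↭ = AllPairs-resp-↭ Disj-sym

  incident? : ∀ v e → Dec (Inc v e)
  incident? v e = (v Fin.≟ proj₁ (ends G e)) ⊎-dec (v Fin.≟ proj₂ (ends G e))

  other-end : ∀ {v e} → Inc v e → ∃ λ v' → Inc v' e × (∀ w → Inc w e → w ≡ v ⊎ w ≡ v')
  other-end {e = e} (inj₁ refl) = proj₂ (ends G e) , inj₂ refl , λ w → id
  other-end {e = e} (inj₂ refl) = proj₁ (ends G e) , inj₁ refl , λ w → Sum.swap

  endpoints : List E → List V
  endpoints []       = []
  endpoints (e ∷ es) = proj₁ (ends G e) ∷ proj₂ (ends G e) ∷ endpoints es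

  length-endpoints : ∀ es → length (endpoints es) ≡ length es + length es
  length-endpoints []       = refl
  length-endpoints (e ∷ es) = cong suc (trans (cong suc (length-endpoints es)) (sym (+-suc _ _)))

  ∈-endpoints⁻ : ∀ {v} es → v ∈ endpoints es → Any (Inc v) es
  ∈-endpoints⁻ (e ∷ es) (here p)          = here (inj₁ p)
  ∈-endpoints⁻ (e ∷ es) (there (here p))  = here (inj₂ p)
  ∈-endpoints⁻ (e ∷ es) (there (there p)) = there (∈-endpoints⁻ es p)

  All-endpoints⁻ : {P : V → Set} → ∀ es → All P (endpoints es) → All (λ e → ∀ v → Inc v e → P v) es
  All-endpoints⁻ []       []           = []
  All-endpoints⁻ (e ∷ es) (p ∷ q ∷ ps) =
    (λ { v (inj₁ refl) → p ; v (inj₂ refl) → q }) ∷ All-endpoints⁻ es ps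

  All-endpoints⁺ : {P : V → Set} → ∀ es → All (λ e → ∀ v → Inc v e → P v) es → All P (endpoints es)
  All-endpoints⁺ []       []       = []
  All-endpoints⁺ (e ∷ es) (p ∷ ps) = p _ (inj₁ refl) ∷ p _ (inj₂ refl) ∷ All-endpoints⁺ es ps

  -- The roundabout form of `u ≢ v` is the disjointness that `avoid` asks for when its relation is
  -- equality.
  endpoints-distinct : ∀ {es} → MatchingList es →
    AllPairs (λ u v → ∀ w → u ≡ w → v ≢ w) (endpoints es)
  endpoints-distinct {[]}     []       = []
  endpoints-distinct {e ∷ es} (d ∷ ds) =
    ((λ { w refl p → loopless G e (sym p) }) ∷ away (inj₁ refl)) ∷ away (inj₂ refl) ∷ endpoints-distinct ds
    where
    away : ∀ {u} → Inc u e → All (λ v → ∀ w → u ≡ w → v ≢ w) (endpoints es)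
    away p = All-endpoints⁺ es (All.map (λ { k v q w refl refl → k w p q }) d)

  -- The matching `A` has `2 * length A` different endpoints, too many to be covered by the
  -- endpoints of `B`.
  uncovered-vertex : ∀ {A B} → MatchingList A → length B < length A →
    ∃ λ v → Any (Inc v) A × All (λ e → ¬ Inc v e) B
  uncovered-vertex {A} {B} matchA B<A
    with avoid Fin._≟_ (endpoints A) (endpoints B) (endpoints-distinct matchA) lt
    where
    lt : length (endpoints B) < length (endpoints A)
    lt rewrite length-endpoints A | length-endpoints B = +-mono-< B<A B<A
  ... | v , vs , A↭ , v∉B = v , ∈-endpoints⁻ A (Any-resp-↭ (↭-sym A↭) (here refl)) ,
        All.map (λ k p → k v p refl) (All-endpoints⁻ B v∉B)

  disjoint-from : ∀ {e v v' es} → (∀ w → Inc w e → w ≡ v ⊎ w ≡ v') →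
    All (λ f → ¬ Inc v f) es → All (λ f → ¬ Inc v' f) es → All (Disj e) es
  disjoint-from cover ¬v ¬v' = All.zipWith (λ { (a , b) w p q → lem a b w (cover w p) q }) (¬v , ¬v')
    where
    lem : ∀ {v v' f} → ¬ Inc v f → ¬ Inc v' f → ∀ w → w ≡ v ⊎ w ≡ v' → ¬ Inc w f
    lem a b w (inj₁ refl) = a
    lem a b w (inj₂ refl) = b

  -- An edge a of A at a vertex missed by B, together with the edge b of B that it meets, is removed
  -- and put back after the recursive call: b can go to one of the two sides, and a then fits on the
  -- other one. No alternating path has to be followed.
  shift-edge : ∀ k A B → length A ≡ k → MatchingList A → MatchingList B → length B < length A →
    ∃₂ λ A' B' → MatchingList A' × MatchingList B' × A' ++ B' ↭ A ++ B
      × suc (length A') ≡ length A × length B' ≡ suc (length B)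
  shift-edge zero A B A≡k _ _ B<A = contradiction (subst (length B <_) A≡k B<A) λ ()
  shift-edge (suc k) A B A≡k matchA matchB B<A with uncovered-vertex matchA B<A
  ... | v , anyA , v∉B with extract anyA
  ...   | a , A₁ , va , A↭ with MatchingList-resp-↭ A↭ matchA | other-end va
  ...     | aA₁ ∷ matchA₁ | v₁ , v₁a , coverA with any? (incident? v₁) B
  -- Both ends of `a` are missed by `B`, so `a` itself can move.
  ...       | no ¬any = A₁ , a ∷ B , matchA₁ , disjoint-from coverA v∉B (All.¬Any⇒All¬ B ¬any) ∷ matchB ,
                ↭-trans (shift a A₁ B) (++⁺ʳ B (↭-sym A↭)) , sym (↭-length A↭) , refl
  ...       | yes anyB with extract anyB
  ...         | b , B₁ , v₁b , B↭ with MatchingList-resp-↭ B↭ matchB | other-end v₁b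
  ...           | bB₁ ∷ matchB₁ | v₂ , v₂b , coverB
    with shift-edge k A₁ B₁ (suc-injective (trans (sym (↭-length A↭)) A≡k)) matchA₁ matchB₁
           (≤-pred (subst₂ _<_ (↭-length B↭) (↭-length A↭) B<A))
  ...             | A₂ , B₂ , matchA₂ , matchB₂ , perm , lenA , lenB = result
    where
    open PermutationReasoning

    v∉ : All (λ f → ¬ Inc v f) (A₁ ++ B₁)
    v∉ = All.++⁺ (All.map (λ d → d v va) aA₁) (All.tail (All-resp-↭ B↭ v∉B))

    v₁∉ : All (λ f → ¬ Inc v₁ f) (A₁ ++ B₁)
    v₁∉ = All.++⁺ (All.map (λ d → d v₁ v₁a) aA₁) (All.map (λ d → d v₁ v₁b) bB₁)

    -- At most one edge of `A₁ ++ B₁` is at `v₂`, because `B₁` has lost `b`. This property does not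
    -- depend on how the edges are split, so after the recursive call `v₂` is still missed by `A₂`
    -- or by `B₂`, and `b` joins that side.
    once : AllPairs (λ e f → Inc v₂ e → ¬ Inc v₂ f) (A₁ ++ B₁)
    once = AllPairs.++⁺ (AllPairs.map (λ d → d v₂) matchA₁) (AllPairs.map (λ d → d v₂) matchB₁)
             (All.universal (λ e → All.map (λ d _ → d v₂ v₂b) bB₁) A₁)

    v∉' : All (λ f → ¬ Inc v f) (A₂ ++ B₂)
    v∉' = All-resp-↭ (↭-sym perm) v∉
    v₁∉' : All (λ f → ¬ Inc v₁ f) (A₂ ++ B₂)
    v₁∉' = All-resp-↭ (↭-sym perm) v₁∉
    once' : All (λ e → All (λ f → Inc v₂ e → ¬ Inc v₂ f) B₂) A₂
    once' = proj₂ (proj₂ (AllPairs-++⁻ A₂ (AllPairs-resp-↭ (λ r p q → r q p) (↭-sym perm) once)))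

    perm' : a ∷ b ∷ A₂ ++ B₂ ↭ A ++ B
    perm' = begin
      a ∷ b ∷ A₂ ++ B₂   ↭⟨ prep a (prep b perm) ⟩
      a ∷ b ∷ A₁ ++ B₁   ↭⟨ prep a (shift b A₁ B₁) ⟨
      a ∷ A₁ ++ b ∷ B₁   ↭⟨ ++⁺ A↭ B↭ ⟨
      A ++ B             ∎

    lenA' : suc (suc (length A₂)) ≡ length A
    lenA' = trans (cong suc lenA) (sym (↭-length A↭))
    lenB' : suc (length B₂) ≡ suc (length B)
    lenB' = cong suc (trans lenB (sym (↭-length B↭)))

    result : ∃₂ λ A' B' → MatchingList A' × MatchingList B' × A' ++ B' ↭ A ++ B
      × suc (length A') ≡ length A × length B' ≡ suc (length B)
    result with any? (incident? v₂) A₂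
    ... | no ¬any = b ∷ A₂ , a ∷ B₂ ,
          disjoint-from coverB (All.++⁻ˡ A₂ v₁∉') (All.¬Any⇒All¬ A₂ ¬any) ∷ matchA₂ ,
          disjoint-from coverA (All.++⁻ʳ A₂ v∉') (All.++⁻ʳ A₂ v₁∉') ∷ matchB₂ ,
          ↭-trans (shift a (b ∷ A₂) B₂) perm' , lenA' , lenB'
    ... | yes any = a ∷ A₂ , b ∷ B₂ ,
          disjoint-from coverA (All.++⁻ˡ A₂ v∉') (All.++⁻ˡ A₂ v₁∉') ∷ matchA₂ ,
          disjoint-from coverB (All.++⁻ʳ A₂ v₁∉') v₂∉B₂ ∷ matchB₂ ,
          ↭-trans (shift b (a ∷ A₂) B₂) (↭-trans (swap b a ↭-refl) perm') , lenA' , lenB'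
      where
      v₂∉B₂ : All (λ f → ¬ Inc v₂ f) B₂
      v₂∉B₂ with extract any
      ... | e , _ , v₂e , A₂↭ = All.map (λ k → k v₂e) (All.head (All-resp-↭ A₂↭ once'))

  -- Equalizing the sizes of the matchings.

  deficit : ℕ → List (List E) → ℕ
  deficit t Ms = sum (map (λ M → t ∸ length M) Ms)

  length-concat-≤ : ∀ t (Ms : List (List E)) → All (λ M → length M ≤ t) Ms →
    length (concat Ms) ≤ length Ms * t
  length-concat-≤ t []       []       = z≤n
  length-concat-≤ t (M ∷ Ms) (p ∷ ps) rewrite length-++ M {concat Ms} =
    +-mono-≤ p (length-concat-≤ t Ms ps)

  -- If some list is shorter than `t`, then another one is longer than `t`, since otherwise the
  -- total would be below `length Ms * t`. Shifting an edge from the long list to the short one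
  -- lowers `deficit` by exactly one, because the long list keeps at least `t` edges. The number `k`
  -- bounds the rounds.
  equalize : ∀ k t Ms → deficit t Ms ≤ k → All MatchingList Ms → length Ms * t ≤ length (concat Ms) →
    ∃ λ Ms' → length Ms' ≡ length Ms × concat Ms' ↭ concat Ms × All MatchingList Ms'
      × All (λ M → t ≤ length M) Ms'
  equalize k t Ms def≤k match big with All.all? (λ M → t ≤? length M) Ms
  ... | yes large = Ms , refl , ↭-refl , match , large
  ... | no ¬large with extract (All.¬All⇒Any¬ (λ M → t ≤? length M) Ms ¬large)
  ...   | B , Ms₁ , t≰B , Ms↭ with any? (λ M → t <? length M) Ms₁
  ...     | no ¬any = contradiction big (<⇒≱ (begin-strict
              length (concat Ms)             ≡⟨ ↭-length (concat-resp-↭ Ms↭) ⟩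
              length (B ++ concat Ms₁)       ≡⟨ length-++ B ⟩
              length B + length (concat Ms₁) <⟨ +-mono-<-≤ (≰⇒> t≰B)
                (length-concat-≤ t Ms₁ (All.map ≮⇒≥ (All.¬Any⇒All¬ Ms₁ ¬any))) ⟩
              t + length Ms₁ * t             ≡⟨ cong (_* t) (↭-length Ms↭) ⟨
              length Ms * t                  ∎))
    where open ≤-Reasoning
  ...     | yes any with extract any
  ...       | A , Ms₂ , t<A , Ms₁↭ with ↭-trans Ms↭ (prep B Ms₁↭)
  ...         | Ms↭' with All-resp-↭ Ms↭' match
  ...           | matchB ∷ matchA ∷ matchMs₂
    with shift-edge _ A B refl matchA matchB (<-trans (≰⇒> t≰B) t<A)
  ...             | A' , B' , matchA' , matchB' , perm , lenA , lenB = go k def≤k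
    where
    perm' : concat (A' ∷ B' ∷ Ms₂) ↭ concat Ms
    perm' = begin
      A' ++ B' ++ concat Ms₂     ≡⟨ ++-assoc A' B' _ ⟨
      (A' ++ B') ++ concat Ms₂   ↭⟨ ++⁺ʳ _ perm ⟩
      (A ++ B) ++ concat Ms₂     ≡⟨ ++-assoc A B _ ⟩
      A ++ B ++ concat Ms₂       ↭⟨ shifts A B ⟩
      B ++ A ++ concat Ms₂       ↭⟨ concat-resp-↭ Ms↭' ⟨
      concat Ms                  ∎
      where open PermutationReasoning

    deficit-drops : suc (deficit t (A' ∷ B' ∷ Ms₂)) ≡ deficit t Ms
    deficit-drops = begin
      suc ((t ∸ length A') + ((t ∸ length B') + D)) ≡⟨ cong (λ x → suc (x + ((t ∸ length B') + D)))
                                                         (m≤n⇒m∸n≡0 (≤-pred (subst (t <_) (sym lenA) t<A))) ⟩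
      suc ((t ∸ length B') + D)                     ≡⟨ cong (λ x → suc ((t ∸ x) + D)) lenB ⟩
      suc (t ∸ suc (length B)) + D                  ≡⟨ cong (_+ D) (+-∸-assoc 1 (≰⇒> t≰B)) ⟨
      (t ∸ length B) + D                            ≡⟨ cong (λ x → (t ∸ length B) + (x + D))
                                                         (m≤n⇒m∸n≡0 (<⇒≤ t<A)) ⟨
      (t ∸ length B) + ((t ∸ length A) + D)         ≡⟨ sum-↭ (↭-map⁺ (λ M → t ∸ length M) Ms↭') ⟨
      deficit t Ms                                  ∎
      where
      open ≡-Reasoning
      D = deficit t Ms₂

    go : ∀ k → deficit t Ms ≤ k → ∃ λ Ms' → length Ms' ≡ length Ms × concat Ms' ↭ concat Ms
      × All MatchingList Ms' × All (λ M → t ≤ length M) Ms'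
    go zero    def≤k = contradiction (subst (_≤ 0) (sym deficit-drops) def≤k) λ ()
    go (suc k) def≤k
      with equalize k t (A' ∷ B' ∷ Ms₂) (≤-pred (subst (_≤ suc k) (sym deficit-drops) def≤k))
             (matchA' ∷ matchB' ∷ matchMs₂)
             (subst₂ _≤_ (cong (_* t) (↭-length Ms↭')) (sym (↭-length perm')) big)
    ... | Ms' , len , perm″ , match' , large =
      Ms' , trans len (sym (↭-length Ms↭')) , ↭-trans perm″ perm' , match' , large

-- Orderings from spread lists

ʳ++-++ : (xs : List A) {ys zs : List A} → (xs ʳ++ ys) ++ zs ≡ xs ʳ++ ys ++ zs
ʳ++-++ []       = refl
ʳ++-++ (x ∷ xs) = ʳ++-++ xs

shift² : (xs ys : List A) {zs zs' : List A} {x y : A} → zs ↭ x ∷ y ∷ zs' →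
  (x ∷ xs) ++ (y ∷ ys) ++ zs' ↭ xs ++ ys ++ zs
shift² xs ys {zs} {zs'} {x} {y} zs↭ = begin
  x ∷ xs ++ y ∷ ys ++ zs'   ↭⟨ prep x (++⁺ˡ xs (shift y ys zs')) ⟨
  x ∷ xs ++ ys ++ y ∷ zs'   ↭⟨ shift x xs _ ⟨
  xs ++ x ∷ ys ++ y ∷ zs'   ↭⟨ ++⁺ˡ xs (shift x ys _) ⟨
  xs ++ ys ++ x ∷ y ∷ zs'   ↭⟨ ++⁺ˡ xs (++⁺ˡ ys zs↭) ⟨
  xs ++ ys ++ zs            ∎
  where open PermutationReasoning

All-take-++ : {P : A → Set} {xs : List A} (k : ℕ) {ys : List A} →
  All P xs → All P (take k ys) → All P (take (length xs + k) (xs ++ ys))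
All-take-++ k []       qs = qs
All-take-++ k (p ∷ ps) qs = p ∷ All-take-++ k ps qs

All-take-prefix : {P : A → Set} {xs : List A} (k : ℕ) {ys : List A} →
  All P xs → k ≤ length xs → All P (take k (xs ++ ys))
All-take-prefix zero    ps       _         = []
All-take-prefix (suc k) (p ∷ ps) (s≤s k≤n) = p ∷ All-take-prefix k ps k≤n

-- Positions are natural numbers rather than elements of `Fin (length xs)`, so that they can be
-- compared across appended lists without casts.
data _[_]=_ {A : Set} : List A → ℕ → A → Set where
  here  : ∀ {x xs} → (x ∷ xs) [ 0 ]= x
  there : ∀ {x y xs i} → xs [ i ]= y → (x ∷ xs) [ suc i ]= y

lookup⇒[]= : (xs : List A) (i : Fin (length xs)) → xs [ toℕ i ]= lookup xs i
lookup⇒[]= (x ∷ xs) Fin.zero    = here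
lookup⇒[]= (x ∷ xs) (Fin.suc i) = there (lookup⇒[]= xs i)

[]=-++ˡ : ∀ {xs : List A} {i x ys} → xs [ i ]= x → (xs ++ ys) [ i ]= x
[]=-++ˡ here      = here
[]=-++ˡ (there p) = there ([]=-++ˡ p)

[]=-++ʳ : ∀ (xs : List A) {i y ys} → ys [ i ]= y → (xs ++ ys) [ length xs + i ]= y
[]=-++ʳ []       p = p
[]=-++ʳ (x ∷ xs) p = there ([]=-++ʳ xs p)

[]=-++⁻ˡ : ∀ (xs : List A) {i x ys} → i < length xs → (xs ++ ys) [ i ]= x → xs [ i ]= x
[]=-++⁻ˡ (x ∷ xs) _         here      = here
[]=-++⁻ˡ (x ∷ xs) (s≤s i<n) (there p) = there ([]=-++⁻ˡ xs i<n p)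

All-take-[]= : ∀ {P : A → Set} {xs : List A} {i x} k → All P (take k xs) → xs [ i ]= x → i < k → P x
All-take-[]= (suc k) (p ∷ ps) here      _         = p
All-take-[]= (suc k) (p ∷ ps) (there q) (s≤s i<k) = All-take-[]= k ps q i<k

unique-lookup-injective : {xs : List A} → Unique xs → ∀ i j → lookup xs i ≡ lookup xs j → i ≡ j
unique-lookup-injective (x∉ ∷ u) Fin.zero    Fin.zero    eq = refl
unique-lookup-injective (x∉ ∷ u) Fin.zero    (Fin.suc j) eq =
  contradiction eq (All.lookup x∉ (∈-lookup j))
unique-lookup-injective (x∉ ∷ u) (Fin.suc i) Fin.zero    eq =
  contradiction (sym eq) (All.lookup x∉ (∈-lookup i))
unique-lookup-injective (x∉ ∷ u) (Fin.suc i) (Fin.suc j) eq = cong Fin.suc (unique-lookup-injective u i j eq)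

-- b is reached from a by d < k steps in ℤ_k, with a, b written as representatives in {0, …, k - 1}.
Steps : (k a d b : ℕ) → Set
Steps k a d b = d < k × (a + d ≡ b ⊎ a + d ≡ b + k)

-- If `a` is at most `b`, the remainder takes off exactly one full turn; otherwise the sum is
-- already below `k` and stays as it is.
cycDist-steps : ∀ {k} (a b : Fin k) → Steps k (toℕ a) (cycDist k a b) (toℕ b)
cycDist-steps {suc k} a b with toℕ a ≤? toℕ b
... | yes a≤b = subst (λ d → Steps (suc k) (toℕ a) d (toℕ b)) (sym dist≡)
      (≤-<-trans (m∸n≤m _ (toℕ a)) (Fin.toℕ<n b) , inj₁ (m+[n∸m]≡n a≤b))
  where
  open ≡-Reasoning
  dist≡ : cycDist (suc k) a b ≡ toℕ b ∸ toℕ a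
  dist≡ = begin
    (toℕ b + (suc k ∸ toℕ a)) % suc k   ≡⟨ cong (_% suc k) (+-∸-assoc (toℕ b) (<⇒≤ (Fin.toℕ<n a))) ⟨
    (toℕ b + suc k ∸ toℕ a) % suc k     ≡⟨ cong (_% suc k) (+-∸-comm (suc k) a≤b) ⟩
    (toℕ b ∸ toℕ a + suc k) % suc k     ≡⟨ [m+n]%n≡m%n (toℕ b ∸ toℕ a) (suc k) ⟩
    (toℕ b ∸ toℕ a) % suc k             ≡⟨ m<n⇒m%n≡m (≤-<-trans (m∸n≤m _ (toℕ a)) (Fin.toℕ<n b)) ⟩
    toℕ b ∸ toℕ a                       ∎
... | no a≰b = subst (λ d → Steps (suc k) (toℕ a) d (toℕ b)) (sym (m<n⇒m%n≡m small)) (small , inj₂ around)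
  where
  open ≤-Reasoning
  small : toℕ b + (suc k ∸ toℕ a) < suc k
  small = begin-strict
    toℕ b + (suc k ∸ toℕ a) <⟨ +-monoˡ-< _ (≰⇒> a≰b) ⟩
    toℕ a + (suc k ∸ toℕ a) ≡⟨ m+[n∸m]≡n (<⇒≤ (Fin.toℕ<n a)) ⟩
    suc k                   ∎
  around : toℕ a + (toℕ b + (suc k ∸ toℕ a)) ≡ toℕ b + suc k
  around = begin-equality
    toℕ a + (toℕ b + (suc k ∸ toℕ a)) ≡⟨ +-assoc (toℕ a) _ _ ⟨
    toℕ a + toℕ b + (suc k ∸ toℕ a)   ≡⟨ cong (_+ (suc k ∸ toℕ a)) (+-comm (toℕ a) _) ⟩
    toℕ b + toℕ a + (suc k ∸ toℕ a)   ≡⟨ +-assoc (toℕ b) _ _ ⟩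
    toℕ b + (toℕ a + (suc k ∸ toℕ a)) ≡⟨ cong (_+_ (toℕ b)) (m+[n∸m]≡n (<⇒≤ (Fin.toℕ<n a))) ⟩
    toℕ b + suc k                     ∎

-- Lists in which nearby edges are not adjacent.

module _ (G : Graph) where
  private
    E = Fin (m G)

  NonAdj : E → E → Set
  NonAdj e f = ¬ Adjacent G e f

  Adjacent-sym : ∀ {e f} → Adjacent G e f → Adjacent G f e
  Adjacent-sym (e≢f , v , p , q) = e≢f ∘ sym , v , q , p

  Disj⇒NonAdj : ∀ {e f} → Disj G e f → NonAdj e f
  Disj⇒NonAdj d (_ , v , p , q) = d v p q

  -- Edges of the list that are at most d places apart are not adjacent; an ordering is therefore
  -- s-separating for s = suc d.
  Spread : ℕ → List E → Set
  Spread d []       = ⊤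
  Spread d (e ∷ es) = All (NonAdj e) (take d es) × Spread d es

  matching-spread : ∀ d {es} → MatchingList G es → Spread d es
  matching-spread d []       = tt
  matching-spread d (e ∷ es) = All.take⁺ d (All.map Disj⇒NonAdj e) , matching-spread d es

  Spread-[]= : ∀ {d es e f} i r → Spread d es → es [ i ]= e → es [ i + suc r ]= f → suc r ≤ d → NonAdj e f
  Spread-[]= zero    r (h , _) here      (there q) r<d = All-take-[]= _ h q r<d
  Spread-[]= (suc i) r (_ , s) (there p) (there q) r<d = Spread-[]= i r s p q r<d

  -- The condition on the pairs that straddle the junction of the reversal of the first list with the
  -- second.
  Cross : ℕ → List E → List E → Set
  Cross d []       fs = ⊤
  Cross d (e ∷ es) fs = All (NonAdj e) (take d fs) × Cross (pred d) es fs

  Cross-zero : ∀ es {fs} → Cross 0 es fs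
  Cross-zero []       = tt
  Cross-zero (e ∷ es) = [] , Cross-zero es

  Cross-cons : ∀ d {e} es {fs} → All (NonAdj e) (take d es) → Cross (pred d) es fs → Cross d es (e ∷ fs)
  Cross-cons d       []       _        _       = tt
  Cross-cons zero    (f ∷ es) _        _       = Cross-zero (f ∷ es)
  Cross-cons (suc d) (f ∷ es) (h ∷ hs) (k , c) = (h ∘ Adjacent-sym ∷ k) , Cross-cons d es hs c

  -- The induction moves the head of `es` across the junction. No distance changes; `Cross-cons`
  -- only turns a condition inside `es` into one across the new junction.
  Spread-ʳ++ : ∀ d es {fs} → Spread d es → Spread d fs → Cross d es fs → Spread d (es ʳ++ fs)
  Spread-ʳ++ d []       _        sf _       = sf
  Spread-ʳ++ d (e ∷ es) (h , se) sf (k , c) = Spread-ʳ++ d es se (k , sf) (Cross-cons d es h c)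

  -- Two edges on different sides of the junction and at most `d` apart are among the first `d` of
  -- their lists, hence in `P` and `Q`.
  Cross-prefix : ∀ d {P Q L R} → All (λ e → All (Disj G e) Q) P → d ≤ length P → d ≤ length Q →
    Cross d (P ++ L) (Q ++ R)
  Cross-prefix zero    {P} {L = L} _   _         _   = Cross-zero (P ++ L)
  Cross-prefix (suc d) (h ∷ hs)    (s≤s d≤P) d<Q =
    All-take-prefix (suc d) (All.map Disj⇒NonAdj h) d<Q , Cross-prefix d hs d≤P (<⇒≤ d<Q)

  -- The `d` edges after an edge of `W` do not reach beyond `P`, so they belong to the same
  -- matching.
  Spread-push : ∀ d W {P L} → MatchingList G (W ++ P) → d ≤ length P → Spread d (P ++ L) →
    Spread d (W ++ P ++ L)
  Spread-push d []              _       _   s = s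
  Spread-push d (e ∷ W) {P} {L} (h ∷ μ) d≤P s =
    subst (All (NonAdj e) ∘ take d) (++-assoc W P L)
      (All-take-prefix d (All.map Disj⇒NonAdj h) (≤-trans d≤P long)) ,
    Spread-push d W μ d≤P s
    where
    long : length P ≤ length (W ++ P)
    long rewrite length-++ W {P} = m≤n+m (length P) (length W)

  -- Arranging the matchings around the cycle.

  choose : ∀ k X L → MatchingList G X → k + k < length X →
    ∃₂ λ x X' → X ↭ x ∷ X' × All (NonAdj x) (take k L)
  choose k X L matchX k<X
    with avoid (λ e v → incident? G v e) X (endpoints G (take k L)) matchX
           (≤-<-trans bound k<X)
    where
    length-take≤ : ∀ k (L : List E) → length (take k L) ≤ k
    length-take≤ zero    L       = z≤n
    length-take≤ (suc k) []      = z≤n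
    length-take≤ (suc k) (_ ∷ L) = s≤s (length-take≤ k L)
    bound : length (endpoints G (take k L)) ≤ k + k
    bound rewrite length-endpoints G (take k L) = +-mono-≤ (length-take≤ k L) (length-take≤ k L)
  ... | x , X' , X↭ , ¬inc = x , X' , X↭ ,
    All.map (λ { h (_ , v , p , q) → h v q p }) (All-endpoints⁻ G (take k L) ¬inc)

  -- P and S are the edges already placed next to L and R. L is kept in reverse order, so both L and R
  -- start with the edge next to the gap that is being filled.
  fill : ∀ d k P S X {L R} → length P + k ≡ suc d → length S + k ≡ suc d →
    MatchingList G (P ++ S ++ X) → Spread d (P ++ L) → Spread d (S ++ R) → k + k ≤ length X →
    ∃₂ λ P' S' → ∃ λ Y → length P' ≡ suc d × length S' ≡ suc d × P' ++ S' ++ Y ↭ P ++ S ++ X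
      × Spread d (P' ++ L) × Spread d (S' ++ R)
  fill d zero P S X lenP lenS _ sL sR _ =
    P , S , X , trans (sym (+-identityʳ _)) lenP , trans (sym (+-identityʳ _)) lenS , ↭-refl , sL , sR
  fill d (suc k) P S X {L} {R} lenP lenS match sL sR big with AllPairs-++⁻ P match
  ... | _ , matchSX , P∥SX with AllPairs-++⁻ S matchSX
  -- The new edge goes in front of `P`, and `length P + k` is `d`, so only the first `k` edges of
  -- `L` are within distance `d` of it.
  ...   | _ , matchX , S∥X with choose k X L matchX (≤-trans (s≤s (+-monoʳ-≤ k (n≤1+n k))) big)
  ...     | x , X₁ , X↭ , x∥L with MatchingList-resp-↭ G X↭ matchX
  -- One of at least `2k + 2` edges was spent on `x`; the `2k + 1` that remain still outnumber the
  -- at most `2k` endpoints at the other side.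
  ...       | _ ∷ matchX₁ with choose k X₁ R matchX₁
                (subst (_≤ length X₁) (+-suc k k) (≤-pred (subst (suc k + suc k ≤_) (↭-length X↭) big)))
  ...         | y , X₂ , X₁↭ , y∥R
    with fill d k (x ∷ P) (y ∷ S) X₂ (lenP' P lenP) (lenP' S lenS)
           (MatchingList-resp-↭ G (↭-sym (shift² P S X↭')) match)
           (close P L lenP x∥P x∥L , sL) (close S R lenS y∥S y∥R , sR)
           (≤-pred (≤-pred (subst₂ _≤_ (cong suc (+-suc k k)) (trans (↭-length X↭) (cong suc (↭-length X₁↭))) big)))
    where
    X↭' = ↭-trans X↭ (prep x X₁↭)

    lenP' : ∀ (Q : List E) → length Q + suc k ≡ suc d → suc (length Q) + k ≡ suc d
    lenP' Q eq = trans (sym (+-suc (length Q) k)) eq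

    x∥P : All (NonAdj x) P
    x∥P = All.map (λ h → Disj⇒NonAdj (Disj-sym G (All.head (All-resp-↭ X↭' (All.++⁻ʳ S h))))) P∥SX

    y∥S : All (NonAdj y) S
    y∥S = All.map (λ h → Disj⇒NonAdj (Disj-sym G (All.head (All.tail (All-resp-↭ X↭' h))))) S∥X

    close : ∀ {e} Q K → length Q + suc k ≡ suc d → All (NonAdj e) Q → All (NonAdj e) (take k K) →
      All (NonAdj e) (take d (Q ++ K))
    close Q K eq e∥Q e∥K = subst (λ d → All _ (take d (Q ++ K)))
      (suc-injective (trans (sym (+-suc (length Q) k)) eq)) (All-take-++ k e∥Q e∥K)
  ...           | P' , S' , Y , lP , lS , perm' , sL' , sR' =
    P' , S' , Y , lP , lS , ↭-trans perm' (shift² P S (↭-trans X↭ (prep x X₁↭))) , sL' , sR'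

  -- Every class but the last is fitted against `L` only and is then added to `L` for the next one.
  -- The last class is fitted against both `L` and `R`, and it is long enough to keep its two fitted
  -- ends from interfering.
  arrange : ∀ d M Ms {L R} → All (MatchingList G) (M ∷ Ms) →
    All (λ M → suc d + suc d ≤ length M) (M ∷ Ms) → Spread d L → Spread d R →
    ∃ λ T → T ↭ M ++ concat Ms × Spread d (L ʳ++ T ++ R)
  arrange d M [] {L} {R} (matchM ∷ _) (big ∷ _) sL sR
    with fill d (suc d) [] [] M refl refl matchM sL sR big
  ... | P , S , Y , lP , lS , perm , sL' , sR' = P ʳ++ Y ++ S , permT , spread
    where
    P++Y++S↭M : P ++ Y ++ S ↭ M
    P++Y++S↭M = ↭-trans (++⁺ˡ P (++-comm Y S)) perm
    permT : P ʳ++ Y ++ S ↭ M ++ []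
    permT = ↭-trans (↭-sym (++↭ʳ++ P (Y ++ S)))
      (↭-trans P++Y++S↭M (↭-reflexive (sym (++-identityʳ M))))
    match' = AllPairs-++⁻ P (MatchingList-resp-↭ G (↭-sym P++Y++S↭M) matchM)
    d≤P : d ≤ length P
    d≤P = ≤-trans (n≤1+n d) (≤-reflexive (sym lP))
    d≤S : d ≤ length S
    d≤S = ≤-trans (n≤1+n d) (≤-reflexive (sym lS))
    d≤YS : d ≤ length (Y ++ S)
    d≤YS rewrite length-++ Y {S} = ≤-trans d≤S (m≤n+m (length S) (length Y))
    spread : Spread d (L ʳ++ (P ʳ++ Y ++ S) ++ R)
    spread = subst (Spread d) (trans (++-ʳ++ P) (cong (L ʳ++_) (sym (ʳ++-++ P))))
      (Spread-ʳ++ d (P ++ L) sL'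
        (subst (Spread d) (sym (++-assoc Y S R)) (Spread-push d Y (proj₁ (proj₂ match')) d≤S sR'))
        (Cross-prefix d (proj₂ (proj₂ match')) d≤P d≤YS))
  arrange d M (M' ∷ Ms) {L} {R} (matchM ∷ match) (big ∷ bigs) sL sR
    -- The empty `R` leaves the far end unconstrained; the next class will be fitted to whatever
    -- stands there.
    with fill d (suc d) [] [] M {R = []} refl refl matchM sL tt big
  ... | P , S , Y , lP , lS , perm , sL' , _
    with arrange d M' Ms match bigs
           (Spread-push d (S ++ Y) (MatchingList-resp-↭ G
             (↭-trans (↭-sym perm) (++-comm P (S ++ Y))) matchM)
             (≤-trans (n≤1+n d) (≤-reflexive (sym lP))) sL') sR
  ...   | T , permT , spread = W ʳ++ T ,
      ↭-trans (↭-sym (++↭ʳ++ W T)) (++⁺ (↭-trans (++-comm (S ++ Y) P) perm) permT) ,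
      subst (Spread d) eq spread
    where
    W = (S ++ Y) ++ P
    open ≡-Reasoning
    eq : ((S ++ Y) ++ P ++ L) ʳ++ T ++ R ≡ L ʳ++ (W ʳ++ T) ++ R
    eq = begin
      ((S ++ Y) ++ P ++ L) ʳ++ T ++ R   ≡⟨ cong (_ʳ++ T ++ R) (++-assoc (S ++ Y) P L) ⟨
      (W ++ L) ʳ++ T ++ R               ≡⟨ ++-ʳ++ W ⟩
      L ʳ++ W ʳ++ T ++ R                ≡⟨ cong (L ʳ++_) (ʳ++-++ W) ⟨
      L ʳ++ (W ʳ++ T) ++ R              ∎

  -- The class `M` is the neighbour on both sides of the gap that `T` fills. Repeating `M` at the
  -- end lets a condition on a linear list express the cyclic one.
  arrange-cyclically : ∀ d M M' Ms → All (MatchingList G) (M ∷ M' ∷ Ms) →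
    All (λ M → suc d + suc d ≤ length M) (M ∷ M' ∷ Ms) →
    ∃ λ T → M ++ T ↭ concat (M ∷ M' ∷ Ms) × Spread d ((M ++ T) ++ M)
  arrange-cyclically d M M' Ms (matchM ∷ match) (_ ∷ bigs)
    with arrange d M' Ms {L = reverse M} {R = M} match bigs
           (matching-spread d (MatchingList-resp-↭ G M↭revM matchM)) (matching-spread d matchM)
    where
    M↭revM : M ↭ reverse M
    M↭revM = ↭-trans (↭-reflexive (sym (++-identityʳ M))) (++↭ʳ++ M [])
  ... | T , perm , spread = T , ++⁺ˡ M perm ,
      subst (Spread d) (trans (ʳ++-ʳ++ M) (sym (++-assoc M T M))) spread

  -- Reading a cyclic list as an ordering.

  listOrdering : ∀ {Q} → Q ↭ allFin (m G) → Σ (Ordering G) λ ℓ → ∀ e → Q [ toℕ (ℓ ⟨$⟩ʳ e) ]= e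
  listOrdering {Q} Q↭ = permutation to from to-from from-to , at
    where
    len : length Q ≡ m G
    len = trans (↭-length Q↭) (length-tabulate id)
    unique : Unique Q
    unique = AllPairs-resp-↭ (λ p → p ∘ sym) (↭-sym Q↭) (Unique.allFin⁺ (m G))
    e∈Q : ∀ e → e ∈ Q
    e∈Q e = ∈-resp-↭ (↭-sym Q↭) (∈-allFin e)
    to : E → E
    to e = Fin.cast len (index (e∈Q e))
    from : E → E
    from i = lookup Q (Fin.cast (sym len) i)
    from-to : ∀ e → from (to e) ≡ e
    from-to e = trans (cong (lookup Q) (Fin.cast-involutive (sym len) len (index (e∈Q e))))
      (sym (lookup-index (e∈Q e)))
    to-from : ∀ i → to (from i) ≡ i
    to-from i = trans (cong (Fin.cast len) (unique-lookup-injective unique _ _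
      (sym (lookup-index (e∈Q (from i)))))) (Fin.cast-involutive len (sym len) i)
    at : ∀ e → Q [ toℕ (to e) ]= e
    at e = subst₂ (Q [_]=_) (sym (Fin.toℕ-cast len (index (e∈Q e)))) (sym (lookup-index (e∈Q e)))
      (lookup⇒[]= Q (index (e∈Q e)))

  -- Suppose that the distance from `e` to `f` is at most `d`. It is not zero, as `e` and `f` have
  -- different labels. Without wrapping, both edges are that close in `M ++ T`. With wrapping, the
  -- position of `f` is below the distance, so `f` lies in `M` and its second copy is that close to
  -- `e`.
  spread⇒separating : ∀ d M T (ℓ : Ordering G) → (∀ e → (M ++ T) [ toℕ (ℓ ⟨$⟩ʳ e) ]= e) →
    length (M ++ T) ≡ m G → suc d ≤ length M → Spread d ((M ++ T) ++ M) → Separating G ℓ (suc d)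
  spread⇒separating d M T ℓ at len d<M spread e f adj = far e f adj , far f e (Adjacent-sym adj)
    where
    open ≤-Reasoning
    far : ∀ e f → Adjacent G e f → suc d ≤ dist G ℓ e f
    far e f adj with suc d ≤? dist G ℓ e f | cycDist-steps (ℓ ⟨$⟩ʳ e) (ℓ ⟨$⟩ʳ f)
    ... | yes d<dist | _ = d<dist
    ... | no ¬d<dist | steps with dist G ℓ e f | ≮⇒≥ ¬d<dist
    ...   | zero | _ = contradiction e≡f (proj₁ adj)
      where
      i<m = Fin.toℕ<n (ℓ ⟨$⟩ʳ e)
      i≡j : toℕ (ℓ ⟨$⟩ʳ e) ≡ toℕ (ℓ ⟨$⟩ʳ f)
      i≡j with proj₂ steps
      ... | inj₁ p = trans (sym (+-identityʳ _)) p
      ... | inj₂ p = contradiction (subst (_< m G) (trans (sym (+-identityʳ _)) p) i<m)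
                       (≤⇒≯ (m≤n+m (m G) _))
      e≡f : e ≡ f
      e≡f = trans (sym (Perm.inverseˡ ℓ)) (trans (cong (ℓ ⟨$⟩ˡ_) (Fin.toℕ-injective i≡j)) (Perm.inverseˡ ℓ))
    ...   | suc r | r<d with proj₂ steps
    ...     | inj₁ p = contradiction adj (Spread-[]= _ r spread ([]=-++ˡ (at e))
                  ([]=-++ˡ (subst ((M ++ T) [_]= f) (sym p) (at f))) r<d)
    ...     | inj₂ p = contradiction adj (Spread-[]= _ r spread ([]=-++ˡ (at e))
                  (subst (((M ++ T) ++ M) [_]= f) (trans (cong (_+ j) len) (trans (+-comm (m G) j) (sym p)))
                    ([]=-++ʳ (M ++ T) ([]=-++⁻ˡ M j<M (at f)))) r<d)
      where
      j = toℕ (ℓ ⟨$⟩ʳ f)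
      j<r : j < suc r
      j<r = +-cancelʳ-< (m G) j (suc r) (begin-strict
        j + m G                 ≡⟨ p ⟨
        toℕ (ℓ ⟨$⟩ʳ e) + suc r  <⟨ +-monoˡ-< (suc r) (Fin.toℕ<n (ℓ ⟨$⟩ʳ e)) ⟩
        m G + suc r             ≡⟨ +-comm (m G) (suc r) ⟩
        suc r + m G             ∎)
      j<M : j < length M
      j<M = <-≤-trans j<r (≤-trans r<d (≤-trans (n≤1+n d) d<M))

  -- Colour classes and the lower bound.

  colour-classes : ∀ {c} (col : E → Fin c) → (∀ e f → Adjacent G e f → col e ≢ col f) →
    ∀ k es → Unique es → All (λ e → toℕ (col e) < k) es →
    ∃ λ Ms → length Ms ≡ k × concat Ms ↭ es × All (MatchingList G) Ms
  colour-classes col proper zero    []       _ _        = [] , refl , ↭-refl , []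
  colour-classes col proper zero    (e ∷ es) _ (() ∷ _)
  colour-classes col proper (suc k) es       u below
    with colour-classes col proper k (filter (¬? ∘ P?) es) (Unique.filter⁺ (¬? ∘ P?) u)
           (All.zipWith (λ { (p , q) → ≤∧≢⇒< (≤-pred p) q })
             (All.filter⁺ (¬? ∘ P?) below , All.all-filter (¬? ∘ P?) es))
    where
    P? : ∀ e → Dec (toℕ (col e) ≡ k)
    P? e = toℕ (col e) ≟ k
  ... | Ms , len , perm , match = filter P? es ∷ Ms , cong suc len ,
      ↭-trans (++⁺ˡ (filter P? es) perm) (↭-sym split) , class (Unique.filter⁺ P? u) (All.all-filter P? es) ∷ match
    where
    P? : ∀ e → Dec (toℕ (col e) ≡ k)
    P? e = toℕ (col e) ≟ k
    split : es ↭ filter P? es ++ filter (¬? ∘ P?) es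
    split = ↭-trans (↭ₛ⇒↭ (SetoidPermutation.partition-↭ (setoid E) P? es))
      (↭-reflexive (cong (λ p → proj₁ p ++ proj₂ p) (partition-defn P? es)))
    class : ∀ {fs} → Unique fs → All (λ e → toℕ (col e) ≡ k) fs → MatchingList G fs
    class []        []       = []
    -- Uniqueness supplies the `e ≢ f` contained in `Adjacent`; a common vertex would then
    -- contradict the equal colours.
    class (e∉ ∷ u) (p ∷ ps) = All.zipWith (λ { (e≢f , q) v i j →
      proper _ _ (e≢f , v , i , j) (Fin.toℕ-injective (trans p (sym q))) }) (e∉ , ps) ∷ class u ps

  separating-ordering : ∀ c s → ProperEdgeColouring G c → c * (s + s) ≤ m G → ∃ λ ℓ → Separating G ℓ s
  separating-ordering c             zero    _              _   = Perm.id , λ _ _ _ → z≤n , z≤n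
  separating-ordering zero          (suc d) (col , _)      _   = Perm.id , λ e → contradiction (col e) Fin.¬Fin0
  -- With a single colour no two edges are adjacent, and every ordering will do. The cyclic
  -- arrangement starts from two classes.
  separating-ordering (suc zero)    (suc d) (col , proper) _   = Perm.id ,
    λ e f adj → contradiction (one (col e) (col f)) (proper e f adj)
    where
    one : (i j : Fin 1) → i ≡ j
    one Fin.zero Fin.zero = refl
  separating-ordering (suc (suc c)) (suc d) (col , proper) big
    with colour-classes col proper (suc (suc c)) (allFin (m G)) (Unique.allFin⁺ (m G))
           (All.universal (λ e → Fin.toℕ<n (col e)) _)
  ... | Ms , len , perm , match
    with equalize G _ (suc d + suc d) Ms ≤-refl match
           (subst₂ _≤_ (cong (_* (suc d + suc d)) (sym len)) (sym (trans (↭-length perm) (length-tabulate id))) big)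
  ...   | [] , len' , _ = contradiction (trans len' len) λ ()
  ...   | _ ∷ [] , len' , _ = contradiction (trans len' len) λ ()
  ...   | M ∷ M' ∷ Ms' , _ , perm' , match' , large with arrange-cyclically d M M' Ms' match' large
  ...     | T , permT , spread with ↭-trans permT (↭-trans perm' perm)
  ...       | Q↭ with listOrdering Q↭
  ...         | ℓ , at = ℓ , spread⇒separating d M T ℓ at (trans (↭-length Q↭) (length-tabulate id))
                  (≤-trans (m≤m+n (suc d) (suc d)) (All.head large)) spread

  adjacent? : ∀ e f → Dec (Adjacent G e f)
  adjacent? e f = ¬? (e Fin.≟ f) ×-dec Fin.any? (λ v → incident? G v e ×-dec incident? G v f)

  separating? : ∀ ℓ s → Dec (Separating G ℓ s)
  separating? ℓ s = Fin.all? λ e → Fin.all? λ f →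
    adjacent? e f →-dec ((s ≤? dist G ℓ e f) ×-dec (s ≤? dist G ℓ f e))

greatest : {P : ℕ → Set} → (∀ i → Dec (P i)) → ∀ {s} b → s ≤ b → P s →
  ∃ λ k → s ≤ k × k ≤ b × P k × (∀ i → i ≤ b → P i → i ≤ k)
greatest P? zero    z≤n ps = 0 , z≤n , z≤n , ps , λ _ i≤0 _ → i≤0
greatest P? (suc b) s≤b ps with P? (suc b)
... | yes p = suc b , s≤b , ≤-refl , p , λ _ i≤b _ → i≤b
... | no ¬p with greatest P? b (≤-pred (≤∧≢⇒< s≤b λ { refl → ¬p ps })) ps
...   | k , s≤k , k≤b , pk , max = k , s≤k , m≤n⇒m≤1+n k≤b , pk ,
        λ i i≤b pi → max i (≤-pred (≤∧≢⇒< i≤b λ { refl → ¬p pi })) pi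

-- `IsCms` compares only values that are greatest for their own ordering, so `s` is first raised to
-- the greatest separating value of `ℓ`, which decidability provides.
separating≤cms : ∀ G {ℓ s k} → IsCms G k → 1 ≤ s → s ≤ m G → Separating G ℓ s → s ≤ k
separating≤cms G {ℓ} {s} (_ , maximal) 1≤s s≤m sep with greatest (separating? G ℓ) (m G) s≤m sep
... | k' , s≤k' , k'≤m , sep' , max =
  ≤-trans s≤k' (maximal ℓ k' ((≤-trans 1≤s s≤k' , k'≤m , sep') , λ i _ → max i))

-- This bounds the floor itself, which is stronger by one than the bound in the theorem. If the
-- floor is positive, it is the `s` of `separating-ordering`.
cms-lower : ∀ G {c k} → ProperEdgeColouring G c → IsCms G k → floorHalfDiv (m G) c ≤ k
cms-lower G {zero}  _   _   = z≤n
cms-lower G {suc c} col cms with m G ℕ./ (2 * suc c) | m/n*n≤m (m G) (2 * suc c)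
... | zero  | _   = z≤n
... | suc d | big with separating-ordering G (suc c) (suc d) col (subst (_≤ m G) (rearrange (suc d) (suc c)) big)
  where
  rearrange : ∀ s c → s * (2 * c) ≡ c * (s + s)
  rearrange = solve-∀
...   | ℓ , sep = separating≤cms G {ℓ} cms (s≤s z≤n) (≤-trans (m≤m*n (suc d) (2 * suc c)) big) sep

-- Calculating with cyclic distances.

Steps-unique : ∀ {k a d d' b} → Steps k a d b → Steps k a d' b → d ≡ d'
Steps-unique {a = a} (_ , inj₁ p) (_ , inj₁ q) = +-cancelˡ-≡ a _ _ (trans p (sym q))
Steps-unique {a = a} (_ , inj₂ p) (_ , inj₂ q) = +-cancelˡ-≡ a _ _ (trans p (sym q))
Steps-unique {k} {a} {d} {d'} (_ , inj₁ refl) (d'<k , inj₂ q) = contradiction d'<k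
  (≤⇒≯ (≤-trans (m≤n+m k d) (≤-reflexive (sym (+-cancelˡ-≡ a _ _ (trans q (+-assoc a d k)))))))
Steps-unique {k} {a} {d} {d'} (d<k , inj₂ p) (_ , inj₁ refl) = contradiction d<k
  (≤⇒≯ (≤-trans (m≤n+m k d') (≤-reflexive (sym (+-cancelˡ-≡ a _ _ (trans p (+-assoc a d' k)))))))

-- The cases record which of the two walks from `i` passes the end of the cycle. The shorter one
-- cannot do so alone, since that would force `y` to be at least `k`.
Steps-∸ : ∀ {k i a x b y} → y < k → Steps k i a x → Steps k i b y → a ≤ b → Steps k x (b ∸ a) y
Steps-∸ {k} {i} {a} {x} {b} {y} y<k (_ , p) (b<k , q) a≤b = ≤-<-trans (m∸n≤m b a) b<k , reach p q
  where
  i+b : i + a + (b ∸ a) ≡ i + b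
  i+b = trans (+-assoc i a (b ∸ a)) (cong (_+_ i) (m+[n∸m]≡n a≤b))
  swapʳ : x + k + (b ∸ a) ≡ x + (b ∸ a) + k
  swapʳ = trans (+-assoc x k _) (trans (cong (_+_ x) (+-comm k _)) (sym (+-assoc x _ k)))
  reach : i + a ≡ x ⊎ i + a ≡ x + k → i + b ≡ y ⊎ i + b ≡ y + k →
    x + (b ∸ a) ≡ y ⊎ x + (b ∸ a) ≡ y + k
  reach (inj₁ p) q = Sum.map (trans eq) (trans eq) q
    where
    eq : x + (b ∸ a) ≡ i + b
    eq = trans (cong (_+ (b ∸ a)) (sym p)) i+b
  reach (inj₂ p) (inj₁ q) = contradiction y<k (≤⇒≯ (subst (k ≤_) eq (m≤n+m k (x + (b ∸ a)))))
    where
    eq : x + (b ∸ a) + k ≡ y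
    eq = trans (sym swapʳ) (trans (cong (_+ (b ∸ a)) (sym p)) (trans i+b q))
  reach (inj₂ p) (inj₂ q) = inj₁ (+-cancelʳ-≡ k _ _
    (trans (sym swapʳ) (trans (cong (_+ (b ∸ a)) (sym p)) (trans i+b q))))

-- From here on a distance is computed by exhibiting a step count, without unfolding the remainder.
cycDist-unique : ∀ {k} {a b : Fin k} {d} → Steps k (toℕ a) d (toℕ b) → cycDist k a b ≡ d
cycDist-unique {a = a} {b} steps = Steps-unique (cycDist-steps a b) steps

cycDist-∸ : ∀ {k} (i a b : Fin k) → cycDist k i a ≤ cycDist k i b →
  cycDist k a b ≡ cycDist k i b ∸ cycDist k i a
cycDist-∸ i a b le = cycDist-unique (Steps-∸ (Fin.toℕ<n b) (cycDist-steps i a) (cycDist-steps i b) le)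

forward : ∀ {k} (a : Fin k) {d} → d < k → ∃ λ b → cycDist k a b ≡ d
forward {k} a {d} d<k with toℕ a + d <? k
... | yes lt = fromℕ< lt , cycDist-unique (d<k , inj₁ (sym (Fin.toℕ-fromℕ< lt)))
... | no ¬lt = fromℕ< lt , cycDist-unique (d<k ,
    inj₂ (sym (trans (cong (_+ k) (Fin.toℕ-fromℕ< lt)) (m∸n+n≡m k≤a+d))))
  where
  k≤a+d = ≮⇒≥ ¬lt
  lt : toℕ a + d ∸ k < k
  lt = +-cancelʳ-< k _ _ (subst (_< k + k) (sym (m∸n+n≡m k≤a+d)) (+-mono-< (Fin.toℕ<n a) d<k))

backward : ∀ {k} (b : Fin k) {d} → d < k → ∃ λ a → cycDist k a b ≡ d
backward {k} b {d} d<k with d ≤? toℕ b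
... | yes le = fromℕ< lt , cycDist-unique (d<k , inj₁ (trans (cong (_+ d) (Fin.toℕ-fromℕ< lt)) (m∸n+n≡m le)))
  where
  lt : toℕ b ∸ d < k
  lt = ≤-<-trans (m∸n≤m (toℕ b) d) (Fin.toℕ<n b)
... | no ¬le = fromℕ< lt , cycDist-unique (d<k , inj₂ (trans (cong (_+ d) (Fin.toℕ-fromℕ< lt))
    (m∸n+n≡m (≤-trans (<⇒≤ d<k) (m≤n+m k (toℕ b))))))
  where
  lt : toℕ b + k ∸ d < k
  lt = +-cancelʳ-< d _ _ (subst₂ _<_ (sym (m∸n+n≡m (≤-trans (<⇒≤ d<k) (m≤n+m k (toℕ b))))) (+-comm d k)
         (+-monoˡ-< k (≰⇒> ¬le)))

-- Windows as a fractional edge colouring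

fromℕ : ℕ → ℚ
fromℕ n = + n / 1

-- The identity is checked on unnormalised fractions, where no common divisors have to be cancelled.
fromℕ-suc : ∀ n → fromℕ (suc n) ≡ 1ℚ +ℚ fromℕ n
fromℕ-suc n = ℚ.toℚᵘ-injective (begin
  ℚ.toℚᵘ (fromℕ (suc n))                  ≈⟨ ℚ.toℚᵘ-fromℚᵘ (ℚᵘ.mkℚᵘ (+ suc n) 0) ⟩
  ℚᵘ.mkℚᵘ (+ suc n) 0                     ≈⟨ ℚᵘ.*≡* (cong (λ i → (+ 1 ℤ.+ i) ℤ.* + 1) (sym (ℤ.*-identityʳ (+ n)))) ⟩
  ℚᵘ.mkℚᵘ (+ 1) 0 ℚᵘ.+ ℚᵘ.mkℚᵘ (+ n) 0    ≈⟨ ℚᵘ.+-congʳ (ℚᵘ.mkℚᵘ (+ 1) 0)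
                                               (ℚᵘ.≃-sym (ℚ.toℚᵘ-fromℚᵘ (ℚᵘ.mkℚᵘ (+ n) 0))) ⟩
  ℚ.toℚᵘ 1ℚ ℚᵘ.+ ℚ.toℚᵘ (fromℕ n)         ≈⟨ ℚ.toℚᵘ-homo-+ 1ℚ (fromℕ n) ⟨
  ℚ.toℚᵘ (1ℚ +ℚ fromℕ n)                 ∎)
  where open ℚᵘ.≃-Reasoning

fromℕ-mono-≤ : ∀ {i j} → i ≤ j → fromℕ i ≤ℚ fromℕ j
fromℕ-mono-≤ {i} {j} i≤j = ℚ.toℚᵘ-cancel-≤ (begin
  ℚ.toℚᵘ (fromℕ i)      ≃⟨ ℚ.toℚᵘ-fromℚᵘ (ℚᵘ.mkℚᵘ (+ i) 0) ⟩
  ℚᵘ.mkℚᵘ (+ i) 0       ≤⟨ ℚᵘ.*≤* (ℤ.*-monoʳ-≤-nonNeg (+ 1) (ℤ.+≤+ i≤j)) ⟩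
  ℚᵘ.mkℚᵘ (+ j) 0       ≃⟨ ℚ.toℚᵘ-fromℚᵘ (ℚᵘ.mkℚᵘ (+ j) 0) ⟨
  ℚ.toℚᵘ (fromℕ j)      ∎)
  where open ℚᵘ.≤-Reasoning

fromℕ-suc-* : ∀ n w → fromℕ (suc n) *ℚ w ≡ w +ℚ fromℕ n *ℚ w
fromℕ-suc-* n w = begin
  fromℕ (suc n) *ℚ w            ≡⟨ cong (_*ℚ w) (fromℕ-suc n) ⟩
  (1ℚ +ℚ fromℕ n) *ℚ w         ≡⟨ ℚ.*-distribʳ-+ w 1ℚ (fromℕ n) ⟩
  1ℚ *ℚ w +ℚ fromℕ n *ℚ w     ≡⟨ cong (_+ℚ fromℕ n *ℚ w) (ℚ.*-identityˡ w) ⟩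
  w +ℚ fromℕ n *ℚ w            ∎
  where open ≡-Reasoning

does≡true : {P : Set} (p? : Dec P) → does p? ≡ true → P
does≡true (yes p) _ = p

module _ (G : Graph) (ℓ : Ordering G) (k : ℕ) where
  private
    E = Fin (m G)

  inWindow? : (i : Fin (m G)) (e : E) → Dec (cycDist (m G) i (ℓ ⟨$⟩ʳ e) < k)
  inWindow? i e = cycDist (m G) i (ℓ ⟨$⟩ʳ e) <? k

  -- Of two edges in the window, the one nearer to `i` reaches the other in fewer than `k` steps, by
  -- `cycDist-∸`, so they are not adjacent.
  window : Separating G ℓ k → Fin (m G) → Matching G
  window sep i = Vec.tabulate (λ e → does (inWindow? i e)) , λ e f p q adj →
    disjoint e f adj (within e p) (within f q)
    where
    within : ∀ e → Vec.lookup (Vec.tabulate (λ e → does (inWindow? i e))) e ≡ true →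
      cycDist (m G) i (ℓ ⟨$⟩ʳ e) < k
    within e p = does≡true (inWindow? i e) (trans (sym (lookup∘tabulate (λ e → does (inWindow? i e)) e)) p)
    near : ∀ e f → cycDist (m G) i (ℓ ⟨$⟩ʳ e) ≤ cycDist (m G) i (ℓ ⟨$⟩ʳ f) →
      cycDist (m G) i (ℓ ⟨$⟩ʳ f) < k → dist G ℓ e f < k
    near e f le lt = subst (_< k) (sym (cycDist-∸ i _ _ le))
      (≤-<-trans (m∸n≤m _ (cycDist (m G) i (ℓ ⟨$⟩ʳ e))) lt)
    disjoint : ∀ e f → Adjacent G e f → cycDist (m G) i (ℓ ⟨$⟩ʳ e) < k → ¬ cycDist (m G) i (ℓ ⟨$⟩ʳ f) < k
    disjoint e f adj e<k f<k with ≤-total (cycDist (m G) i (ℓ ⟨$⟩ʳ e)) (cycDist (m G) i (ℓ ⟨$⟩ʳ f))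
    ... | inj₁ le = ≤⇒≯ (proj₁ (sep e f adj)) (near e f le f<k)
    ... | inj₂ ge = ≤⇒≯ (proj₂ (sep e f adj)) (near f e ge e<k)

  windows : Separating G ℓ k → ℚ → List (Fin (m G)) → Weighting G
  windows sep w = map (λ i → window sep i , w)

  hits : E → List (Fin (m G)) → ℕ
  hits e is = length (filter (λ i → inWindow? i e) is)

  weight-windows : ∀ sep w is → weight G (windows sep w is) ≡ fromℕ (length is) *ℚ w
  weight-windows sep w []       = sym (ℚ.*-zeroˡ w)
  weight-windows sep w (i ∷ is) =
    trans (cong (w +ℚ_) (weight-windows sep w is)) (sym (fromℕ-suc-* (length is) w))

  weightAt-windows : ∀ sep w is e → weightAt G (windows sep w is) e ≡ fromℕ (hits e is) *ℚ w
  weightAt-windows sep w []       e = sym (ℚ.*-zeroˡ w)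
  weightAt-windows sep w (i ∷ is) e
    rewrite lookup∘tabulate (λ e → does (inWindow? i e)) e with does (inWindow? i e)
  ... | true  = trans (cong (w +ℚ_) (weightAt-windows sep w is e)) (sym (fromℕ-suc-* (hits e is) w))
  ... | false = weightAt-windows sep w is e

  -- For each `d < k` some window starts `d` steps before the label of `e`. Different `d` give
  -- different starts, because the distance recovers `d`, so `Fin k` injects into the positions of
  -- the windows that contain `e`.
  hits-allFin : k ≤ m G → ∀ e → k ≤ hits e (allFin (m G))
  hits-allFin k≤m e = Fin.injective⇒≤ {f = λ d → index (start∈ d)} λ {c} {d} eq →
    Fin.toℕ-injective (begin
      toℕ c                                       ≡⟨ proj₂ (start c) ⟨
      cycDist (m G) (proj₁ (start c)) (ℓ ⟨$⟩ʳ e)  ≡⟨ cong (λ i → cycDist (m G) i (ℓ ⟨$⟩ʳ e)) (same c d eq) ⟩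
      cycDist (m G) (proj₁ (start d)) (ℓ ⟨$⟩ʳ e)  ≡⟨ proj₂ (start d) ⟩
      toℕ d                                       ∎)
    where
    open ≡-Reasoning
    hitting = filter (λ i → inWindow? i e) (allFin (m G))
    start : (d : Fin k) → ∃ λ i → cycDist (m G) i (ℓ ⟨$⟩ʳ e) ≡ toℕ d
    start d = backward (ℓ ⟨$⟩ʳ e) (<-≤-trans (Fin.toℕ<n d) k≤m)
    start∈ : ∀ d → proj₁ (start d) ∈ hitting
    start∈ d = ∈-filter⁺ (λ i → inWindow? i e) (∈-allFin _)
      (subst (_< k) (sym (proj₂ (start d))) (Fin.toℕ<n d))
    same : ∀ c d → index (start∈ c) ≡ index (start∈ d) → proj₁ (start c) ≡ proj₁ (start d)
    same c d eq = trans (lookup-index (start∈ c))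
      (trans (cong (lookup hitting) eq) (sym (lookup-index (start∈ d))))

fromℕ-inverse : ∀ k → fromℕ (suc k) *ℚ (+ 1 / suc k) ≡ 1ℚ
fromℕ-inverse k = ℚ.toℚᵘ-injective (begin
  ℚ.toℚᵘ (fromℕ (suc k) *ℚ (+ 1 / suc k))           ≈⟨ ℚ.toℚᵘ-homo-* (fromℕ (suc k)) (+ 1 / suc k) ⟩
  ℚ.toℚᵘ (fromℕ (suc k)) ℚᵘ.* ℚ.toℚᵘ (+ 1 / suc k)   ≈⟨ ℚᵘ.*-cong (ℚ.toℚᵘ-fromℚᵘ (ℚᵘ.mkℚᵘ (+ suc k) 0))
                                                                     (ℚ.toℚᵘ-fromℚᵘ (ℚᵘ.mkℚᵘ (+ 1) k)) ⟩
  ℚᵘ.mkℚᵘ (+ suc k) 0 ℚᵘ.* ℚᵘ.mkℚᵘ (+ 1) k           ≈⟨ ℚᵘ.*≡* (cong +_ (cross-multiplied k)) ⟩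
  ℚ.toℚᵘ 1ℚ                                            ∎)
  where
  open ℚᵘ.≃-Reasoning
  cross-multiplied : ∀ k → suc k * 1 * 1 ≡ 1 * (1 * suc k)
  cross-multiplied = solve-∀

cms-upper : ∀ G {k} → IsCms G k → ∀ cf → LowerBoundFrac G cf → fromℕ k *ℚ cf ≤ℚ fromℕ (m G)
cms-upper G {zero} ((_ , (() , _) , _) , _) cf bound
cms-upper G {suc k} ((ℓ , (_ , k≤m , sep) , _) , _) cf bound = begin
  -- The weighting by windows is tested against `cf`; the factor `suc k` then cancels the weight
  -- `1 / suc k` of each window.
  fromℕ (suc k) *ℚ cf                    ≤⟨ ℚ.*-monoˡ-≤-nonNeg (fromℕ (suc k)) {{nonNeg k}}
                                               (bound ω (nonNegative , covers)) ⟩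
  fromℕ (suc k) *ℚ weight G ω            ≡⟨ cong (fromℕ (suc k) *ℚ_) (weight-windows G ℓ (suc k) sep w (allFin (m G))) ⟩
  fromℕ (suc k) *ℚ (fromℕ (length (allFin (m G))) *ℚ w)
                                          ≡⟨ cong (λ i → fromℕ (suc k) *ℚ (fromℕ i *ℚ w))
                                               (length-tabulate {n = m G} id) ⟩
  fromℕ (suc k) *ℚ (fromℕ (m G) *ℚ w)   ≡⟨ ℚ.*-assoc (fromℕ (suc k)) (fromℕ (m G)) w ⟨
  fromℕ (suc k) *ℚ fromℕ (m G) *ℚ w     ≡⟨ cong (_*ℚ w) (ℚ.*-comm (fromℕ (suc k)) (fromℕ (m G))) ⟩
  fromℕ (m G) *ℚ fromℕ (suc k) *ℚ w     ≡⟨ ℚ.*-assoc (fromℕ (m G)) (fromℕ (suc k)) w ⟩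
  fromℕ (m G) *ℚ (fromℕ (suc k) *ℚ w)   ≡⟨ cong (fromℕ (m G) *ℚ_) (fromℕ-inverse k) ⟩
  fromℕ (m G) *ℚ 1ℚ                      ≡⟨ ℚ.*-identityʳ (fromℕ (m G)) ⟩
  fromℕ (m G)                             ∎
  where
  open ℚ.≤-Reasoning
  w = + 1 / suc k
  ω = windows G ℓ (suc k) sep w (allFin (m G))
  nonNeg : ∀ j → ℚ.NonNegative (fromℕ (suc j))
  nonNeg j = ℚ.normalize-nonNeg (suc j) 1
  w-nonNeg : ℚ.NonNegative w
  w-nonNeg = ℚ.normalize-nonNeg 1 (suc k)
  nonNegative : All (λ p → 0ℚ ≤ℚ proj₂ p) ω
  nonNegative = All.map⁺ (All.universal (λ _ → ℚ.nonNegative⁻¹ w {{w-nonNeg}}) (allFin (m G)))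
  covers : ∀ e → 1ℚ ≤ℚ weightAt G ω e
  covers e = begin
    1ℚ                    ≡⟨ fromℕ-inverse k ⟨
    fromℕ (suc k) *ℚ w   ≤⟨ ℚ.*-monoʳ-≤-nonNeg w {{w-nonNeg}} (fromℕ-mono-≤ (hits-allFin G ℓ (suc k) k≤m e)) ⟩
    fromℕ (hits G ℓ (suc k) e (allFin (m G))) *ℚ w
                          ≡⟨ weightAt-windows G ℓ (suc k) sep w (allFin (m G)) e ⟨
    weightAt G ω e        ∎

-- A star with an extra edge

module _ (j : ℕ) where

  -- The centre is 0; edge 0 joins the leaves 1 and 2, and edge i > 0 joins the centre to i.
  starEdges : Fin (3 + j) → Fin (3 + j) × Fin (3 + j)
  starEdges Fin.zero    = Fin.suc Fin.zero , Fin.suc (Fin.suc Fin.zero)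
  starEdges (Fin.suc i) = Fin.zero , Fin.suc i

  starPlusEdge : Graph
  starPlusEdge = record { n = 3 + j ; m = 3 + j ; ends = starEdges ; loopless = loopless' ; simple = simple' }
    where
    loopless' : ∀ e → proj₁ (starEdges e) ≢ proj₂ (starEdges e)
    loopless' Fin.zero    ()
    loopless' (Fin.suc e) ()
    simple' : ∀ e f → ((proj₁ (starEdges e) ≡ proj₁ (starEdges f) × proj₂ (starEdges e) ≡ proj₂ (starEdges f))
      ⊎ (proj₁ (starEdges e) ≡ proj₂ (starEdges f) × proj₂ (starEdges e) ≡ proj₁ (starEdges f))) → e ≡ f
    simple' Fin.zero    Fin.zero    _                = refl
    simple' Fin.zero    (Fin.suc f) (inj₁ (() , _))
    simple' Fin.zero    (Fin.suc f) (inj₂ (_ , ()))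
    simple' (Fin.suc e) Fin.zero    (inj₁ (() , _))
    simple' (Fin.suc e) Fin.zero    (inj₂ (() , _))
    simple' (Fin.suc e) (Fin.suc f) (inj₁ (_ , p))   = p
    simple' (Fin.suc e) (Fin.suc f) (inj₂ (() , _))

  cms-starPlusEdge≤1 : ∀ {k} → IsCms starPlusEdge k → k ≤ 1
  cms-starPlusEdge≤1 {k} ((ℓ , (_ , _ , sep) , _) , _)
    -- The cycle has at least three labels, so the two that follow the label of edge 0 belong to two
    -- different star edges. These meet in the centre and are at distance 1.
    with forward (ℓ ⟨$⟩ʳ Fin.zero) {1} (s≤s (s≤s z≤n)) | forward (ℓ ⟨$⟩ʳ Fin.zero) {2} (s≤s (s≤s (s≤s z≤n)))
  ... | q , p→q | r , p→r = subst (k ≤_) dist≡1 (proj₁ (sep e f (star-adjacent e f e≢0 f≢0 e≢f)))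
    where
    p = ℓ ⟨$⟩ʳ Fin.zero
    e = ℓ ⟨$⟩ˡ q
    f = ℓ ⟨$⟩ˡ r
    p→p : cycDist (3 + j) p p ≡ 0
    p→p = cycDist-unique (s≤s z≤n , inj₁ (+-identityʳ (toℕ p)))
    q→r : cycDist (3 + j) q r ≡ 1
    q→r = trans (cycDist-∸ p q r (subst₂ _≤_ (sym p→q) (sym p→r) (s≤s z≤n))) (cong₂ _∸_ p→r p→q)
    dist≡1 : dist starPlusEdge ℓ e f ≡ 1
    dist≡1 = trans (cong₂ (cycDist (3 + j)) (Perm.inverseʳ ℓ) (Perm.inverseʳ ℓ)) q→r
    label : ∀ {x c} → cycDist (3 + j) p x ≡ suc c → ℓ ⟨$⟩ˡ x ≢ Fin.zero
    label p→x x≡0 = 0≢1+n (trans (sym p→p)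
      (trans (cong (cycDist (3 + j) p) (trans (cong (ℓ ⟨$⟩ʳ_) (sym x≡0)) (Perm.inverseʳ ℓ))) p→x))
    e≢0 : e ≢ Fin.zero
    e≢0 = label p→q
    f≢0 : f ≢ Fin.zero
    f≢0 = label p→r
    e≢f : e ≢ f
    e≢f e≡f = 1≢2 (trans (sym p→q) (trans (cong (cycDist (3 + j) p)
      (trans (sym (Perm.inverseʳ ℓ)) (trans (cong (ℓ ⟨$⟩ʳ_) e≡f) (Perm.inverseʳ ℓ)))) p→r))
      where
      1≢2 : 1 ≢ 2
      1≢2 ()
    star-adjacent : ∀ e f → e ≢ Fin.zero → f ≢ Fin.zero → e ≢ f → Adjacent starPlusEdge e f
    star-adjacent Fin.zero    f           e≢0 _   _   = contradiction refl e≢0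
    star-adjacent (Fin.suc e) Fin.zero    _   f≢0 _   = contradiction refl f≢0
    star-adjacent (Fin.suc e) (Fin.suc f) _   _   e≢f = e≢f , Fin.zero , inj₁ refl , inj₁ refl

theorem1p3 : ((G : Graph) → 1 ≤ m G → (c k : ℕ) → IsChromaticIndex G c → IsCms G k →
    (floorHalfDiv (m G) c ∸ 1 ≤ k)
    × ((cf : ℚ) → LowerBoundFrac G cf → (+ k / 1) *ℚ cf ≤ℚ (+ m G / 1)))
    × ((Δ n : ℕ) → 2 ≤ Δ → Δ + 1 ≤ n →
    Σ Graph (λ G → (Graph.n G ≡ n) × (1 ≤ m G)
    × ((k : ℕ) → IsCms G k → k * (Δ + 1) ≤ m G)))
theorem1p3 =
  (λ G _ c k (colouring , _) cms → ≤-trans (m∸n≤m _ 1) (cms-lower G colouring cms) , cms-upper G cms) ,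
  λ Δ n 2≤Δ Δ<n → construct Δ n Δ<n (≤-trans (subst (3 ≤_) (+-comm 1 Δ) (s≤s 2≤Δ)) Δ<n)
  where
  construct : ∀ Δ n → Δ + 1 ≤ n → 3 ≤ n →
    Σ Graph (λ G → (Graph.n G ≡ n) × (1 ≤ m G) × ((k : ℕ) → IsCms G k → k * (Δ + 1) ≤ m G))
  -- The same graph serves for all `Δ`: it has `n` edges, and `k ≤ 1` leaves only `Δ + 1 ≤ n` to be
  -- shown.
  construct Δ (suc (suc (suc j))) Δ<n (s≤s (s≤s (s≤s z≤n))) = starPlusEdge j , refl , s≤s z≤n , λ k cms →
    ≤-trans (*-monoˡ-≤ (Δ + 1) (cms-starPlusEdge≤1 j cms)) (≤-trans (≤-reflexive (*-identityˡ (Δ + 1))) Δ<n)
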